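{- For every integer $n \geqslant 5$, the line graph $L(K_n)$ of the complete graph $K_n$ is not representable.
   Context: All graphs are finite and simple. For a word $W$ over an alphabet, two distinct letters $x,y$ alternate in $W$ if both occur in $W$ and, after erasing all other letters from $W$, one obtains a word of the form $xyxy\ldots$ or $yxyx\ldots$ (an alternating word of any length). A graph $G=(V,E)$ is representable if there exists a word $W$ over the alphabet $V$ in which every vertex occurs, such that for all distinct $x,y\in V$, the letters $x$ and $y$ alternate in $W$ if and only if $(x,y)\in E$. The line graph $L(G)$ of a graph $G$ has the edges of $G$ as vertices, two of them being adjacent in $L(G)$ iff they share an endpoint in $G$. -}

module Defs where

open import Data.Fin.Base as Fin using (Fin; zero; suc)
import Data.Fin.Properties as Fin
open import Data.Irrelevant using ([_])
open import Data.List.Base using (List; []; _∷_; filter)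
open import Data.List.Membership.Propositional using (_∈_)
open import Data.Nat.Base using (ℕ; zero; suc)
open import Data.Product.Base using (∃-syntax; _×_; _,_; proj₁; proj₂)
open import Data.Product.Function.NonDependent.Propositional using (_×-↔_)
open import Data.Refinement using (Refinement; Refinement-syntax; _,_; value; proof)
open import Data.Refinement.Properties using (value-injective)
open import Data.Sum.Base using (_⊎_; inj₁; inj₂)
open import Function.Base using (_∘_)
open import Function.Bundles using (_↔_; _⇔_; mk↔ₛ′; module Inverse)
open import Function.Construct.Composition using (_↔-∘_)
open import Function.Construct.Identity using (↔-id)
open import Function.Construct.Symmetry using (↔-sym)
open import Function.Properties.Inverse using (↔⇒↣)
open import Level using (0ℓ)
open import Relation.Binary.Core using (Rel)
open import Relation.Binary.Definitions
  using (Decidable; DecidableEquality; Irreflexive; Symmetric)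
open import Relation.Binary.PropositionalEquality
  using (_≡_; _≢_; refl; sym; cong; subst; ≢-sym)
open import Relation.Nullary.Decidable using (yes; no; ¬?; _×-dec_; _⊎-dec_; map′)
open import Relation.Nullary.Negation using (contradiction-irr)
open import Relation.Unary as Unary using (Pred)

record Graph : Set₁ where
  field
    Vertex : Set
    order  : ℕ
    finite : Vertex ↔ Fin order
    Adj    : Rel Vertex 0ℓ
    adj?   : Decidable Adj
    symm   : Symmetric Adj
    irrefl : Irreflexive _≡_ Adj

  index : Vertex → Fin order
  index = Inverse.to finite

  _≟_ : DecidableEquality Vertex
  _≟_ = Fin.inj⇒≟ (↔⇒↣ finite)

module _ {A : Set} where

  -- The word xyxy… of length k.
  alternating : A → A → ℕ → List A
  alternating x y zero    = []
  alternating x y (suc k) = x ∷ alternating y x k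

  module _ (_≟_ : DecidableEquality A) where

    restrict : A → A → List A → List A
    restrict x y = filter (λ z → (z ≟ x) ⊎-dec (z ≟ y))

    Alternate : List A → A → A → Set
    Alternate w x y = x ∈ w × y ∈ w ×
      ∃[ k ] (restrict x y w ≡ alternating x y k ⊎ restrict x y w ≡ alternating y x k)

module _ (G : Graph) where
  open Graph G

  Represents : List Vertex → Set
  Represents w =
    (∀ x → x ∈ w) × (∀ x y → x ≢ y → Alternate _≟_ w x y ⇔ Adj x y)

  Representable : Set
  Representable = ∃[ w ] Represents w

complete : ℕ → Graph
complete n = record
  { Vertex = Fin n
  ; order  = n
  ; finite = ↔-id (Fin n)
  ; Adj    = _≢_
  ; adj?   = λ i j → ¬? (i Fin.≟ j)
  ; symm   = ≢-sym
  ; irrefl = λ i≡j i≢j → i≢j i≡j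
  }

-- Decidable subsets of finite types are finite.

Fin-refinement-finite : ∀ {n} {P : Pred (Fin n) 0ℓ} → Unary.Decidable P →
                        ∃[ m ] (Refinement (Fin n) P ↔ Fin m)
Fin-refinement-finite {zero} P? = 0 , mk↔ₛ′ value (λ ()) (λ ()) (λ { (() , _) })
Fin-refinement-finite {suc n} {P} P? with P? zero | Fin-refinement-finite (P? ∘ suc)
... | yes p | m , rest = suc m , mk↔ₛ′ to from to∘from from∘to
  where
  module R = Inverse rest
  to : Refinement (Fin (suc n)) P → Fin (suc m)
  to (zero  , _) = zero
  to (suc i , q) = suc (R.to (i , q))
  from : Fin (suc m) → Refinement (Fin (suc n)) P
  from zero    = zero , [ p ]
  from (suc j) = suc (value (R.from j)) , proof (R.from j)
  to∘from : ∀ j → to (from j) ≡ j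
  to∘from zero    = refl
  to∘from (suc j) = cong suc (R.strictlyInverseˡ j)
  from∘to : ∀ x → from (to x) ≡ x
  from∘to (zero  , _) = refl
  from∘to (suc i , q) =
    value-injective (cong (suc ∘ value) (R.strictlyInverseʳ (i , q)))
... | no ¬p | m , rest = m , mk↔ₛ′ to from R.strictlyInverseˡ from∘to
  where
  module R = Inverse rest
  to : Refinement (Fin (suc n)) P → Fin m
  to (zero  , [ p ]) = contradiction-irr p ¬p
  to (suc i , q)     = R.to (i , q)
  from : Fin m → Refinement (Fin (suc n)) P
  from j = suc (value (R.from j)) , proof (R.from j)
  from∘to : ∀ x → from (to x) ≡ x
  from∘to (zero  , [ p ]) = contradiction-irr p ¬p
  from∘to (suc i , q)     =
    value-injective (cong (suc ∘ value) (R.strictlyInverseʳ (i , q)))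

refinement-finite : ∀ {A : Set} {n} {P : Pred A 0ℓ} → A ↔ Fin n → Unary.Decidable P →
                    ∃[ m ] (Refinement A P ↔ Fin m)
refinement-finite {A} {n} {P} A↔Fin P?
  with m , rest ← Fin-refinement-finite (P? ∘ Inverse.from A↔Fin)
  = m , rest ↔-∘ mk↔ₛ′ to from
          (λ { (i , _) → value-injective (E.strictlyInverseˡ i) })
          (λ { (x , _) → value-injective (E.strictlyInverseʳ x) })
  where
  module E = Inverse A↔Fin
  to : Refinement A P → Refinement (Fin n) (P ∘ E.from)
  to (x , [ p ]) = E.to x , [ subst P (sym (E.strictlyInverseʳ x)) p ]
  from : Refinement (Fin n) (P ∘ E.from) → Refinement A P
  from (i , p) = E.from i , p

module _ (G : Graph) where
  open Graph G

  -- An edge is an unordered pair of adjacent vertices; it is encoded by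
  -- listing the endpoint of smaller index first, so that each edge occurs
  -- exactly once.
  IsEdge : Pred (Vertex × Vertex) 0ℓ
  IsEdge (u , v) = Adj u v × index u Fin.< index v

  isEdge? : Unary.Decidable IsEdge
  isEdge? (u , v) = adj? u v ×-dec (index u Fin.<? index v)

  Edge : Set
  Edge = [ e ∈ Vertex × Vertex ∣ IsEdge e ]

  edges-finite : ∃[ m ] (Edge ↔ Fin m)
  edges-finite =
    refinement-finite (↔-sym (Fin.*↔× {order} {order}) ↔-∘ (finite ×-↔ finite)) isEdge?

  _EndpointOf_ : Vertex → Edge → Set
  x EndpointOf e = x ≡ proj₁ (value e) ⊎ x ≡ proj₂ (value e)

  endpointOf? : Decidable _EndpointOf_
  endpointOf? x e = (x ≟ proj₁ (value e)) ⊎-dec (x ≟ proj₂ (value e))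

  ShareEndpoint : Rel Edge 0ℓ
  ShareEndpoint e f = ∃[ x ] (x EndpointOf e × x EndpointOf f)

  shareEndpoint? : Decidable ShareEndpoint
  shareEndpoint? e f = map′ to from
    (endpointOf? (proj₁ (value e)) f ⊎-dec endpointOf? (proj₂ (value e)) f)
    where
    to : proj₁ (value e) EndpointOf f ⊎ proj₂ (value e) EndpointOf f → ShareEndpoint e f
    to (inj₁ p) = _ , inj₁ refl , p
    to (inj₂ p) = _ , inj₂ refl , p
    from : ShareEndpoint e f → proj₁ (value e) EndpointOf f ⊎ proj₂ (value e) EndpointOf f
    from (_ , inj₁ refl , p) = inj₁ p
    from (_ , inj₂ refl , p) = inj₂ p

  lineGraph : Graph
  lineGraph = record
    { Vertex = Edge
    ; order  = proj₁ edges-finite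
    ; finite = proj₂ edges-finite
    ; Adj    = λ e f → e ≢ f × ShareEndpoint e f
    ; adj?   = λ e f → ¬? (Fin.inj⇒≟ (↔⇒↣ (proj₂ edges-finite)) e f) ×-dec shareEndpoint? e f
    ; symm   = λ { (e≢f , x , p , q) → ≢-sym e≢f , x , q , p }
    ; irrefl = λ { e≡f (e≢f , _) → e≢f e≡f }
    }

{-# OPTIONS --safe #-}

-- In a word representing a graph, the letters of a triangle v, x, y follow one
-- another in a fixed cyclic order, either v x y or v y x.  If v is adjacent to
-- x, y and z, and both v x y and v y z are cyclic orders, then the four letters
-- follow one another in the cyclic order v x y z, so x and z alternate as well.
-- Hence "x comes before y cyclically, seen from v" transitively orients the
-- neighbourhood of v.  In L(Kₙ) the neighbourhood of the edge 01 contains a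
-- triangular prism with triangles 02, 03, 04 and 12, 13, 14, which has no
-- transitive orientation: of its three rungs two point in the same direction,
-- and then neither orientation of the side joining them is possible.

module Submission where

open import Defs
open import Data.Nat.Base using (ℕ; suc; _+_; _≥_; z≤n; s≤s)
open import Relation.Nullary.Negation using (¬_; contradiction)
open import Data.Empty using (⊥)
open import Data.Fin.Base using (Fin; zero; suc)
open import Data.Irrelevant using ([_])
open import Data.List.Base using (List; []; _∷_)
open import Data.List.Membership.Propositional using (_∈_; _∉_)
open import Data.List.Properties using (∷-injective; filter-accept; filter-reject; filter-≐)
open import Data.List.Relation.Unary.Any using (here; there)
open import Data.Product.Base using (∃-syntax; _×_; _,_; proj₁; proj₂)
open import Data.Nat.Properties using (m≤n⇒∃[o]m+o≡n)
open import Data.Refinement using (_,_)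
open import Data.Sum.Base using (_⊎_; inj₁; inj₂; [_,_]′; swap)
open import Function.Base using (_∘_)
open import Function.Bundles using (module Equivalence)
open import Relation.Binary.Definitions using (DecidableEquality)
open import Relation.Binary.PropositionalEquality
  using (_≡_; _≢_; refl; sym; trans; cong; ≢-sym)
open import Relation.Nullary.Decidable using (Dec; yes; no; _⊎-dec_)

-- Alternation and cyclic order in a word

module _ {A : Set} where

  private variable
    u v x y z a b c d : A
    w : List A

  -- The restriction of w to the two distinct letters x and y is a prefix of xyxy….
  data Alternating (x y : A) : List A → Set where
    []   : x ≢ y → Alternating x y []
    take : Alternating y x w → Alternating x y (x ∷ w)
    skip : u ≢ x → u ≢ y → Alternating x y w → Alternating x y (u ∷ w)

  distinct : Alternating x y w → x ≢ y
  distinct ([] x≢y)     = x≢y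
  distinct (take p)     = ≢-sym (distinct p)
  distinct (skip _ _ p) = distinct p

  asymmetric : Alternating x y w → Alternating y x w → y ∉ w
  asymmetric (take p)         (take _)       = contradiction refl (distinct p)
  asymmetric (take _)         (skip _ x≢x _) = contradiction refl x≢x
  asymmetric (skip _ y≢y _)   (take _)       = contradiction refl y≢y
  asymmetric (skip _ u≢y _)   (skip _ _ _)   (here y≡u)  = u≢y (sym y≡u)
  asymmetric (skip _ _ p)     (skip _ _ q)   (there y∈w) = asymmetric p q y∈w

  -- Under the hypotheses each of the three letters has to wait for another one, so none can be the
  -- first of them to occur.
  acyclic : Alternating x y w → Alternating y z w → Alternating z x w → z ∉ w
  acyclic (take p)       (take q)       _              = contradiction refl (distinct p)
  acyclic (take _)       (skip _ _ _)   (take r)       = contradiction refl (distinct r)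
  acyclic (take _)       (skip _ _ _)   (skip _ x≢x _) = contradiction refl x≢x
  acyclic (skip _ y≢y _) (take _)       _              = contradiction refl y≢y
  acyclic (skip _ _ _)   (skip _ z≢z _) (take _)       = contradiction refl z≢z
  acyclic (skip _ _ p)   (skip _ u≢z q) (skip _ _ r)   =
    λ { (here z≡u) → u≢z (sym z≡u) ; (there z∈w) → acyclic p q r z∈w }

  -- Of the four letters only `a` can occur first: `b` and `d` wait for `a`, and `c` waits for `b`.
  -- After this `a` the hypotheses hold for the rest of the word with the cycle rotated to
  -- `b c d a`, which exchanges the two diagonals.
  diagonals : a ≢ c → b ≢ d →
              Alternating a b w → Alternating b c w → Alternating c d w → Alternating a d w →
              Alternating a c w × Alternating b d w
  diagonals a≢c b≢d ([] _) _ _ _ = [] a≢c , [] b≢d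
  diagonals a≢c b≢d (take p) (skip _ _ q) (skip _ _ r) (take s)
    with bd , ca ← diagonals b≢d (≢-sym a≢c) q r s p
    = take ca , skip (≢-sym (distinct p)) (≢-sym (distinct s)) bd
  diagonals a≢c b≢d (skip u≢a u≢b p) (skip _ u≢c q) (skip _ u≢d r) (skip _ _ s)
    with ac , bd ← diagonals a≢c b≢d p q r s
    = skip u≢a u≢c ac , skip u≢b u≢d bd
  diagonals _   _ (take p)       (take _)       _              _              = contradiction refl (distinct p)
  diagonals a≢c _ (take _)       (skip _ _ _)   (take _)       _              = contradiction refl a≢c
  diagonals _   _ (take _)       (skip _ _ _)   (skip _ _ _)   (skip a≢a _ _) = contradiction refl a≢a
  diagonals _   _ (skip _ b≢b _) (take _)       _              _              = contradiction refl b≢b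
  diagonals _   _ (skip _ _ _)   (skip _ c≢c _) (take _)       _              = contradiction refl c≢c
  diagonals _   _ (skip a≢a _ _) (skip _ _ _)   (skip _ _ _)   (take _)       = contradiction refl a≢a

  -- The constructors are named by the order of the first occurrences.
  data Cyclic (w : List A) (v x y : A) : Set where
    vxy : Alternating v x w → Alternating x y w → Alternating v y w → Cyclic w v x y
    xyv : Alternating x y w → Alternating y v w → Alternating x v w → Cyclic w v x y
    yvx : Alternating y v w → Alternating v x w → Alternating y x w → Cyclic w v x y

  Alternating± : List A → A → A → Set
  Alternating± w x y = Alternating x y w ⊎ Alternating y x w

  -- The eight choices of signs are the tournaments on three letters. Six are linear orders, each a
  -- rotation of `v x y` or of `v y x`; the other two are directed cycles, which `acyclic` excludes
  -- because `v` occurs.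
  cyclic : v ∈ w → Alternating± w v x → Alternating± w v y → Alternating± w x y →
           Cyclic w v x y ⊎ Cyclic w v y x
  cyclic _   (inj₁ vx) (inj₁ vy) (inj₁ xy) = inj₁ (vxy vx xy vy)
  cyclic _   (inj₁ vx) (inj₁ vy) (inj₂ yx) = inj₂ (vxy vy yx vx)
  cyclic v∈w (inj₁ vx) (inj₂ yv) (inj₁ xy) = contradiction v∈w (acyclic xy yv vx)
  cyclic _   (inj₁ vx) (inj₂ yv) (inj₂ yx) = inj₁ (yvx yv vx yx)
  cyclic _   (inj₂ xv) (inj₁ vy) (inj₁ xy) = inj₂ (yvx xv vy xy)
  cyclic v∈w (inj₂ xv) (inj₁ vy) (inj₂ yx) = contradiction v∈w (acyclic yx xv vy)
  cyclic _   (inj₂ xv) (inj₂ yv) (inj₁ xy) = inj₁ (xyv xy yv xv)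
  cyclic _   (inj₂ xv) (inj₂ yv) (inj₂ yx) = inj₂ (xyv yx xv yv)

  -- If both triples put `v` and `y` in the same order, they merge into a rotation of `v x y z`, in
  -- which `x` and `z` are opposite, so `diagonals` applies.
  cyclic-trans : v ∈ w → x ≢ z → Cyclic w v x y → Cyclic w v y z → Alternating± w x z
  cyclic-trans _ x≢z (vxy vx xy vy) (vxy _ yz vz) =
    inj₁ (proj₂ (diagonals (distinct vy) x≢z vx xy yz vz))
  cyclic-trans _ x≢z (vxy vx xy vy) (yvx zv _ zy) =
    inj₂ (proj₁ (diagonals (≢-sym x≢z) (distinct vy) zv vx xy zy))
  cyclic-trans _ x≢z (xyv xy yv xv) (xyv yz zv _) =
    inj₁ (proj₁ (diagonals x≢z (distinct yv) xy yz zv xv))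
  cyclic-trans _ x≢z (yvx yv vx yx) (xyv yz zv _) =
    inj₂ (proj₂ (diagonals (distinct yv) (≢-sym x≢z) yz zv vx yx))
  -- From here on the triples disagree about which of `v` and `y` comes first.
  cyclic-trans v∈w _ (vxy _ _ vy) (xyv _ _ yv) = contradiction v∈w (asymmetric yv vy)
  cyclic-trans v∈w _ (xyv _ yv _) (vxy vy _ _) = contradiction v∈w (asymmetric yv vy)
  cyclic-trans v∈w _ (xyv _ yv _) (yvx _ vy _) = contradiction v∈w (asymmetric yv vy)
  cyclic-trans v∈w _ (yvx yv _ _) (vxy vy _ _) = contradiction v∈w (asymmetric yv vy)
  cyclic-trans v∈w _ (yvx yv _ _) (yvx _ vy _) = contradiction v∈w (asymmetric yv vy)

  -- Agreement with alternation defined by restriction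

  module _ (_≟_ : DecidableEquality A) where

    among? : ∀ x y z → Dec (z ≡ x ⊎ z ≡ y)
    among? x y z = (z ≟ x) ⊎-dec (z ≟ y)

    restrict-comm : ∀ x y w → restrict _≟_ x y w ≡ restrict _≟_ y x w
    restrict-comm x y = filter-≐ (among? x y) (among? y x) (swap , swap)

    alternating⁺ : ∀ k w → x ≢ y → restrict _≟_ x y w ≡ alternating x y k → Alternating x y w
    alternating⁺ k [] x≢y _ = [] x≢y
    alternating⁺ {x} {y} k (u ∷ w) x≢y eq with u ≟ x | u ≟ y
    alternating⁺ {y = y} (suc k) (u ∷ w) x≢y eq | yes refl | _ =
      -- The tail alternates with the two letters exchanged, so they are exchanged in the filter
      -- too.
      take (alternating⁺ k w (≢-sym x≢y)
        (trans (restrict-comm y u w) (proj₂ (∷-injective eq))))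
    alternating⁺ (suc k) (u ∷ w) x≢y eq | no u≢x | yes _ =
      contradiction (proj₁ (∷-injective eq)) u≢x
    alternating⁺ k (u ∷ w) x≢y eq | no u≢x | no u≢y =
      skip u≢x u≢y (alternating⁺ k w x≢y eq)

    alternating⁻ : Alternating x y w → ∃[ k ] restrict _≟_ x y w ≡ alternating x y k
    alternating⁻ ([] _) = 0 , refl
    alternating⁻ {x} {y} (take {w = w} p) with k , eq ← alternating⁻ p =
      suc k , trans (filter-accept (among? x y) (inj₁ refl))
                    (cong (x ∷_) (trans (restrict-comm x y w) eq))
    alternating⁻ {x} {y} (skip u≢x u≢y p) with k , eq ← alternating⁻ p =
      k , trans (filter-reject (among? x y) [ u≢x , u≢y ]′) eq

    alternate⁺ : x ≢ y → Alternate _≟_ w x y → Alternating± w x y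
    alternate⁺ x≢y (_ , _ , k , inj₁ eq) = inj₁ (alternating⁺ k _ x≢y eq)
    alternate⁺ {x} {y} {w} x≢y (_ , _ , k , inj₂ eq) =
      inj₂ (alternating⁺ k _ (≢-sym x≢y) (trans (restrict-comm y x w) eq))

    alternate⁻ : x ∈ w → y ∈ w → Alternating± w x y → Alternate _≟_ w x y
    alternate⁻ x∈w y∈w (inj₁ p) with k , eq ← alternating⁻ p =
      x∈w , y∈w , k , inj₁ eq
    alternate⁻ {x} {w} {y} x∈w y∈w (inj₂ p) with k , eq ← alternating⁻ p =
      x∈w , y∈w , k , inj₂ (trans (restrict-comm x y w) eq)

-- Orientation of the neighbourhood of a vertex

module _ (G : Graph) {w : List (Graph.Vertex G)} (rep : Represents G w)
         (v : Graph.Vertex G) where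

  open Graph G using (Adj; irrefl; _≟_)

  adjacent⇒alternating : ∀ {x y} → Adj x y → Alternating± w x y
  adjacent⇒alternating {x} {y} xy = alternate⁺ _≟_ x≢y (Equivalence.from (proj₂ rep x y x≢y) xy)
    where
    x≢y : x ≢ y
    x≢y x≡y = irrefl x≡y xy

  alternating⇒adjacent : ∀ {x y} → x ≢ y → Alternating± w x y → Adj x y
  alternating⇒adjacent {x} {y} x≢y =
    Equivalence.to (proj₂ rep x y x≢y) ∘ alternate⁻ _≟_ (proj₁ rep x) (proj₁ rep y)

  orient : ∀ {x y} → Adj v x → Adj v y → Adj x y → Cyclic w v x y ⊎ Cyclic w v y x
  orient vx vy xy = cyclic (proj₁ rep v)
    (adjacent⇒alternating vx) (adjacent⇒alternating vy) (adjacent⇒alternating xy)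

  -- Directing the side from `a` to `a′` yields the path `a a′ b′`, and the other direction yields
  -- `a′ a b`; transitivity would make the ends of that path adjacent.
  not-parallel : ∀ {a b a′ b′} → Adj v a → Adj v a′ → Adj a a′ →
                 a ≢ b′ → ¬ Adj a b′ → a′ ≢ b → ¬ Adj a′ b →
                 Cyclic w v a b → Cyclic w v a′ b′ → ⊥
  not-parallel va va′ aa′ a≢b′ a≁b′ a′≢b a′≁b a→b a′→b′ with orient va va′ aa′
  ... | inj₁ a→a′ = a≁b′ (alternating⇒adjacent a≢b′ (cyclic-trans (proj₁ rep v) a≢b′ a→a′ a′→b′))
  ... | inj₂ a′→a = a′≁b (alternating⇒adjacent a′≢b (cyclic-trans (proj₁ rep v) a′≢b a′→a a→b))

-- The prism in the neighbourhood of the edge 01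

module _ (m : ℕ) where

  open Graph (lineGraph (complete (5 + m))) using (Adj; symm)

  base : Edge (complete (5 + m))
  base = (zero , suc zero) , [ (λ ()) , s≤s z≤n ]

  -- The index `i` stands for the vertex i + 2, which is never 0 or 1, so the smaller endpoint comes
  -- first uniformly in `i`.
  edge₀ edge₁ : Fin (3 + m) → Edge (complete (5 + m))
  edge₀ i = (zero , suc (suc i)) , [ (λ ()) , s≤s z≤n ]
  edge₁ i = (suc zero , suc (suc i)) , [ (λ ()) , s≤s (s≤s z≤n) ]

  base~edge₀ : ∀ i → Adj base (edge₀ i)
  base~edge₀ i = (λ ()) , zero , inj₁ refl , inj₁ refl

  base~edge₁ : ∀ i → Adj base (edge₁ i)
  base~edge₁ i = (λ ()) , suc zero , inj₂ refl , inj₁ refl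

  edge₀~edge₀ : ∀ {i j} → i ≢ j → Adj (edge₀ i) (edge₀ j)
  edge₀~edge₀ i≢j = (λ { refl → i≢j refl }) , zero , inj₁ refl , inj₁ refl

  edge₁~edge₁ : ∀ {i j} → i ≢ j → Adj (edge₁ i) (edge₁ j)
  edge₁~edge₁ i≢j = (λ { refl → i≢j refl }) , suc zero , inj₁ refl , inj₁ refl

  edge₀~edge₁ : ∀ i → Adj (edge₀ i) (edge₁ i)
  edge₀~edge₁ i = (λ ()) , suc (suc i) , inj₂ refl , inj₂ refl

  edge₀≢edge₁ : ∀ {i j} → edge₀ i ≢ edge₁ j
  edge₀≢edge₁ ()

  -- Only the second endpoints can coincide, since 0 and 1 differ from each other and from every
  -- vertex shifted by two.
  edge₀≁edge₁ : ∀ {i j} → i ≢ j → ¬ Adj (edge₀ i) (edge₁ j)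
  edge₀≁edge₁ i≢j (_ , _ , inj₁ refl , inj₁ ())
  edge₀≁edge₁ i≢j (_ , _ , inj₁ refl , inj₂ ())
  edge₀≁edge₁ i≢j (_ , _ , inj₂ refl , inj₁ ())
  edge₀≁edge₁ i≢j (_ , _ , inj₂ refl , inj₂ refl) = i≢j refl

  lineGraph-not-representable : ¬ Representable (lineGraph (complete (5 + m)))
  lineGraph-not-representable (w , rep) = two-parallel (rung i₀) (rung i₁) (rung i₂)
    where
    _⇒_ : ∀ _ _ → Set
    _⇒_ = Cyclic w base

    -- Three rungs are needed for two of them to share a direction; five vertices provide just
    -- these.
    i₀ i₁ i₂ : Fin (3 + m)
    i₀ = zero
    i₁ = suc zero
    i₂ = suc (suc zero)

    rung : ∀ i → edge₀ i ⇒ edge₁ i ⊎ edge₁ i ⇒ edge₀ i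
    rung i = orient (lineGraph (complete (5 + m))) rep base
      (base~edge₀ i) (base~edge₁ i) (edge₀~edge₁ i)

    not-both₀₁ : ∀ {i j} → i ≢ j → edge₀ i ⇒ edge₁ i → edge₀ j ⇒ edge₁ j → ⊥
    not-both₀₁ i≢j = not-parallel (lineGraph (complete (5 + m))) rep base
      (base~edge₀ _) (base~edge₀ _) (edge₀~edge₀ i≢j)
      edge₀≢edge₁ (edge₀≁edge₁ i≢j) edge₀≢edge₁ (edge₀≁edge₁ (≢-sym i≢j))

    not-both₁₀ : ∀ {i j} → i ≢ j → edge₁ i ⇒ edge₀ i → edge₁ j ⇒ edge₀ j → ⊥
    not-both₁₀ i≢j = not-parallel (lineGraph (complete (5 + m))) rep base
      (base~edge₁ _) (base~edge₁ _) (edge₁~edge₁ i≢j)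
      (≢-sym edge₀≢edge₁) (edge₀≁edge₁ (≢-sym i≢j) ∘ symm)
      (≢-sym edge₀≢edge₁) (edge₀≁edge₁ i≢j ∘ symm)

    two-parallel : edge₀ i₀ ⇒ edge₁ i₀ ⊎ edge₁ i₀ ⇒ edge₀ i₀ →
                   edge₀ i₁ ⇒ edge₁ i₁ ⊎ edge₁ i₁ ⇒ edge₀ i₁ →
                   edge₀ i₂ ⇒ edge₁ i₂ ⊎ edge₁ i₂ ⇒ edge₀ i₂ → ⊥
    two-parallel (inj₁ p) (inj₁ q) _        = not-both₀₁ (λ ()) p q
    two-parallel (inj₂ p) (inj₂ q) _        = not-both₁₀ (λ ()) p q
    two-parallel (inj₁ p) (inj₂ _) (inj₁ r) = not-both₀₁ (λ ()) p r
    two-parallel (inj₁ _) (inj₂ q) (inj₂ r) = not-both₁₀ (λ ()) q r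
    two-parallel (inj₂ _) (inj₁ q) (inj₁ r) = not-both₀₁ (λ ()) q r
    two-parallel (inj₂ p) (inj₁ _) (inj₂ r) = not-both₁₀ (λ ()) p r

theorem3 : ∀ (n : ℕ) → n ≥ 5 → ¬ Representable (lineGraph (complete n))
theorem3 n n≥5 = from-offset (m≤n⇒∃[o]m+o≡n n≥5)
  where
  -- A with-abstraction here would normalise the goal, which is very large.
  from-offset : ∃[ m ] 5 + m ≡ n → ¬ Representable (lineGraph (complete n))
  from-offset (m , refl) = lineGraph-not-representable m
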